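{- Let $C_{(\leq,<)}(x,y)$ be the bivariate generating function of the Catalan words avoiding the ordered pair of relations $(\leq,<)$, where $x$ marks the length and $y$ marks the number of descents. Then $$C_{(\leq,<)}(x,y)=\frac{1 + x^2 - x^2y}{1 - x - x^2y}.$$
   Context: A Catalan word of length $n$ is a word $w=w_1w_2\cdots w_n$ over the non-negative integers with $w_1=0$ and $0\leq w_i\leq w_{i-1}+1$ for $i=2,\dots,n$; the empty word is the unique Catalan word of length $0$. For relations $X,Y\in\{<,>,\leq,\geq,=,\neq\}$, a word $w$ contains the pattern $(X,Y)$ if there is an index $i\geq 1$ (with $i+2\le n$) such that $w_i\,X\,w_{i+1}$ and $w_{i+1}\,Y\,w_{i+2}$; otherwise $w$ avoids $(X,Y)$. The number of descents $\mathrm{des}(w)$ is the number of indices $i$ with $w_i>w_{i+1}$. The bivariate generating function is $C_{(X,Y)}(x,y)=\sum_{w}x^{|w|}y^{\mathrm{des}(w)}$, the sum being over all Catalan words $w$ (of any length $|w|\geq 0$) avoiding $(X,Y)$. Identities are between formal power series in $x$ with coefficients polynomials in $y$. -}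

module Defs where

open import Algebra.Bundles.Raw using (RawRing)
import Algebra.Definitions.RawSemiring as RawSemiringDefinitions
open import Data.Bool.Base using (if_then_else_)
open import Data.Integer.Base as ℤ using (ℤ; 0ℤ; 1ℤ)
open import Data.List.Base
  using (List; []; _∷_; [_]; _++_; length; map; concat; filter; foldr; replicate; upTo)
import Data.List.Properties as List
open import Data.List.Membership.Propositional using (_∈_)
open import Data.List.Membership.Propositional.Properties
  using (∈-map⁺; ∈-map⁻; ∈-concat⁺′; ∈-concat⁻′; ∈-upTo⁺; ∈-upTo⁻)
open import Data.List.Relation.Unary.All using ([]; universal)
import Data.List.Relation.Unary.All.Properties as All
open import Data.List.Relation.Unary.AllPairs using ([]; _∷_)
import Data.List.Relation.Unary.AllPairs as AllPairs
import Data.List.Relation.Unary.AllPairs.Properties as AllPairs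
open import Data.List.Relation.Unary.Any using (here)
open import Data.List.Relation.Unary.Linked using (Linked; []; [-]; _∷_)
open import Data.List.Relation.Unary.Unique.Propositional using (Unique)
import Data.List.Relation.Unary.Unique.Propositional.Properties as Unique
open import Data.Nat.Base using (ℕ; zero; suc; _∸_; _≤_; z≤n; s≤s; s≤s⁻¹)
open import Data.Nat.Properties using (_<?_; suc-injective)
open import Data.Product.Base using (∃-syntax; _×_; _,_)
open import Function.Bundles using (_⇔_; mk⇔)
open import Level using (Level; 0ℓ)
open import Relation.Binary.Core using (Rel)
open import Relation.Binary.Definitions using (Decidable)
open import Relation.Binary.PropositionalEquality.Core using (_≡_; refl; sym; trans; cong)
open import Relation.Nullary.Decidable using (Dec; yes; no; does; ¬?; map′; _×-dec_; _⊎-dec_)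
open import Relation.Nullary.Negation using (¬_)
open import Data.Sum.Base using (_⊎_; inj₁; inj₂)

------------------------------------------------------------------------
-- Catalan words

Word : Set
Word = List ℕ

Step : Rel ℕ 0ℓ
Step a b = b ≤ suc a

data IsCatalan : Word → Set where
  empty : IsCatalan []
  start : ∀ {w} → Linked Step (0 ∷ w) → IsCatalan (0 ∷ w)

data Contains (X Y : Rel ℕ 0ℓ) : Word → Set where
  here  : ∀ {a b c w} → X a b → Y b c → Contains X Y (a ∷ b ∷ c ∷ w)
  there : ∀ {a w} → Contains X Y w → Contains X Y (a ∷ w)

Avoids : (X Y : Rel ℕ 0ℓ) → Word → Set
Avoids X Y w = ¬ Contains X Y w

module _ {X Y : Rel ℕ 0ℓ} (X? : Decidable X) (Y? : Decidable Y) where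

  contains? : (w : Word) → Dec (Contains X Y w)
  contains? []       = no λ ()
  contains? (_ ∷ []) = no λ { (there ()) }
  contains? (_ ∷ _ ∷ []) = no λ { (there (there ())) }
  contains? (a ∷ w@(b ∷ c ∷ _)) =
    map′ to from ((X? a b ×-dec Y? b c) ⊎-dec contains? w)
    where
    to : (X a b × Y b c) ⊎ Contains X Y w → Contains X Y (a ∷ w)
    to (inj₁ (x , y)) = here x y
    to (inj₂ p)       = there p

    from : Contains X Y (a ∷ w) → (X a b × Y b c) ⊎ Contains X Y w
    from (here x y) = inj₁ (x , y)
    from (there p)  = inj₂ p

  avoids? : (w : Word) → Dec (Avoids X Y w)
  avoids? w = ¬? (contains? w)

des : Word → ℕ
des []          = 0
des (_ ∷ [])    = 0
des (a ∷ w@(b ∷ _)) = if does (b <? a) then suc (des w) else des w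

-- All words of length n whose first letter is at most m and in which each
-- letter exceeds its predecessor by at most one.
wordsFrom : (m n : ℕ) → List Word
wordsFrom m zero    = [ [] ]
wordsFrom m (suc n) =
  concat (map (λ a → map (a ∷_) (wordsFrom (suc a) n)) (upTo (suc m)))

catalanWords : ℕ → List Word
catalanWords = wordsFrom 0


data StartsAtMost (m : ℕ) : Word → Set where
  []  : StartsAtMost m []
  _∷_ : ∀ {a} → a ≤ m → ∀ w → StartsAtMost m (a ∷ w)

private
  sound : ∀ m n {w} → w ∈ wordsFrom m n →
          StartsAtMost m w × Linked Step w × length w ≡ n
  sound m zero    (here refl) = [] , [] , refl
  sound m (suc n) w∈
    with _ , w∈v , v∈ ← ∈-concat⁻′ (map _ (upTo (suc m))) w∈
    with a , a∈ , refl ← ∈-map⁻ (λ a → map (a ∷_) (wordsFrom (suc a) n)) v∈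
    with u , u∈ , refl ← ∈-map⁻ (a ∷_) w∈v
    with s , l , e ← sound (suc a) n u∈
    = s≤s⁻¹ (∈-upTo⁻ a∈) ∷ u , link s l , cong suc e
    where
    link : ∀ {a u} → StartsAtMost (suc a) u → Linked Step u → Linked Step (a ∷ u)
    link []      _ = [-]
    link (p ∷ _) l = p ∷ l

  complete : ∀ m {w} → StartsAtMost m w → Linked Step w → w ∈ wordsFrom m (length w)
  complete m []      _ = here refl
  complete m (_∷_ {a} a≤m u) l =
    ∈-concat⁺′ (∈-map⁺ (a ∷_) (tail l)) (∈-map⁺ _ (∈-upTo⁺ (s≤s a≤m)))
    where
    tail : ∀ {u} → Linked Step (a ∷ u) → u ∈ wordsFrom (suc a) (length u)
    tail [-]                       = here refl
    tail (_∷_ {xs = v} p l′) = complete (suc a) (p ∷ v) l′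

∈-catalanWords : ∀ n w → w ∈ catalanWords n ⇔ (IsCatalan w × length w ≡ n)
∈-catalanWords n w = mk⇔ to from
  where
  to : ∀ {w} → w ∈ catalanWords n → IsCatalan w × length w ≡ n
  to w∈ with sound 0 n w∈
  ... | []      , _ , e = empty , e
  ... | z≤n ∷ _ , l , e = start l , e

  from : ∀ {w} → IsCatalan w × length w ≡ n → w ∈ catalanWords n
  from (empty   , refl) = here refl
  from (start {v} l , refl) = complete 0 (z≤n ∷ v) l

catalanWords-unique : ∀ n → Unique (catalanWords n)
catalanWords-unique = unique 0
  where
  unique : ∀ m n → Unique (wordsFrom m n)
  unique m zero    = [] ∷ []
  unique m (suc n) = Unique.concat⁺
    (All.map⁺ (universal (λ a → Unique.map⁺ List.∷-injectiveʳ (unique (suc a) n)) _))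
    (AllPairs.map⁺ (AllPairs.map disjoint (Unique.upTo⁺ (suc m))))
    where
    disjoint : ∀ {a b} → ¬ a ≡ b → ∀ {v} →
               ¬ (v ∈ map (a ∷_) (wordsFrom (suc a) n) × v ∈ map (b ∷_) (wordsFrom (suc b) n))
    disjoint a≢b (p , q)
      with _ , _ , e ← ∈-map⁻ _ p | _ , _ , f ← ∈-map⁻ _ q
      = a≢b (List.∷-injectiveˡ (trans (sym e) f))

------------------------------------------------------------------------
-- The polynomial ring ℤ[y]: coefficient lists, constant term first,
-- identified when they differ only by trailing zeros.

Poly : Set
Poly = List ℤ

coeff : Poly → ℕ → ℤ
coeff []      _       = 0ℤ
coeff (a ∷ _) zero    = a
coeff (_ ∷ p) (suc k) = coeff p k

_+ₚ_ : Poly → Poly → Poly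
[]      +ₚ q       = q
(a ∷ p) +ₚ []      = a ∷ p
(a ∷ p) +ₚ (b ∷ q) = a ℤ.+ b ∷ (p +ₚ q)

_*ₚ_ : Poly → Poly → Poly
[]      *ₚ q = []
(a ∷ p) *ₚ q = map (a ℤ.*_) q +ₚ (0ℤ ∷ (p *ₚ q))

ℤ[y] : RawRing 0ℓ 0ℓ
ℤ[y] = record
  { Carrier = Poly
  ; _≈_     = λ p q → ∀ k → coeff p k ≡ coeff q k
  ; _+_     = _+ₚ_
  ; _*_     = _*ₚ_
  ; -_      = map (λ a → ℤ.- a)
  ; 0#      = []
  ; 1#      = [ 1ℤ ]
  }

y^_ : ℕ → Poly
y^ k = replicate k 0ℤ ++ [ 1ℤ ]

------------------------------------------------------------------------
-- Formal power series in x, as coefficient sequences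

module _ {c ℓ : Level} (R : RawRing c ℓ) where

  private module R = RawRing R

  ∑ : List R.Carrier → R.Carrier
  ∑ = foldr R._+_ R.0#

  constant : R.Carrier → ℕ → R.Carrier
  constant r zero    = r
  constant r (suc _) = R.0#

  variableₓ : ℕ → R.Carrier
  variableₓ (suc zero) = R.1#
  variableₓ _          = R.0#

  PowerSeries : RawRing c ℓ
  PowerSeries = record
    { Carrier = ℕ → R.Carrier
    ; _≈_     = λ f g → ∀ n → f n R.≈ g n
    ; _+_     = λ f g n → f n R.+ g n
    ; _*_     = λ f g n → ∑ (map (λ i → f i R.* g (n ∸ i)) (upTo (suc n)))
    ; -_      = λ f n → R.- f n
    ; 0#      = constant R.0#
    ; 1#      = constant R.1#
    }

ℤ[y]⟦x⟧ : RawRing 0ℓ 0ℓ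
ℤ[y]⟦x⟧ = PowerSeries ℤ[y]

open RawRing ℤ[y]⟦x⟧ public
  using (1#; _+_; _*_; -_; _≈_) renaming (Carrier to Series)

open RawSemiringDefinitions (RawRing.rawSemiring ℤ[y]⟦x⟧) public using (_^_)

infixl 6 _-_
_-_ : Series → Series → Series
f - g = f + (- g)

x y : Series
x = variableₓ ℤ[y]
y = constant ℤ[y] (y^ 1)

-- The fraction f = g / h: the denominator h has a multiplicative inverse
-- and f is g times that inverse.
infix 4 _≈_/_
_≈_/_ : Series → Series → Series → Set
f ≈ g / h = ∃[ h⁻¹ ] (h * h⁻¹ ≈ 1# × f ≈ g * h⁻¹)

------------------------------------------------------------------------
-- The coefficient of xⁿ is the sum of y^des(w) over the Catalan words w of
-- length n avoiding (X , Y).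

C : {X Y : Rel ℕ 0ℓ} → Decidable X → Decidable Y → Series
C X? Y? n = ∑ ℤ[y] (map (λ w → y^ des w) (filter (avoids? X? Y?) (catalanWords n)))

{-# OPTIONS --safe #-}
module Submission where

-- A prefix ab of an avoiding word determines which letters may follow, so the
-- words are grouped by their last two letters read so far. Starting from 0,
-- only 00, 01, 11, 10 occur: after a weak ascent the next letter cannot rise,
-- and a descent 10 resets the state to that of the initial 0. This yields the
-- recurrence c(n+2) = c(n+1) + y c(n) for n ≥ 1, whose characteristic series is
-- the denominator. With Fₙ the coefficients of its reciprocal, both sides have
-- xⁿ⁺²-coefficient Fₙ₊₁ + Fₙ.

open import Defs
open import Data.Nat.Properties using (_≤?_; _<?_)
open import Data.Bool.Base using (true; false)
open import Data.Integer.Base as ℤ using (0ℤ; 1ℤ; -1ℤ)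
import Data.Integer.Properties as ℤ
open import Data.Integer.Tactic.RingSolver using (solve-∀)
open import Data.List.Base
  using (List; []; _∷_; [_]; _++_; map; concat; filter; applyUpTo; upTo)
open import Data.List.Properties using (++-identityʳ; filter-++; map-++; map-∘)
open import Data.Nat.Base as ℕ using (ℕ; zero; suc; _∸_; _≤_; _<_)
import Data.Nat.Properties as ℕ
open import Data.Product.Base using (_,_)
open import Relation.Binary.PropositionalEquality
  using (_≡_; refl; sym; trans; cong; cong₂; subst; module ≡-Reasoning)
open import Relation.Nullary.Decidable using (does; yes; no)

open ≡-Reasoning

-- Coefficientwise arithmetic in the polynomial ring.

coeff-+ : ∀ p q k → coeff (p +ₚ q) k ≡ coeff p k ℤ.+ coeff q k
coeff-+ []      q       k       = sym (ℤ.+-identityˡ _)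
coeff-+ (_ ∷ _) []      k       = sym (ℤ.+-identityʳ _)
coeff-+ (_ ∷ _) (_ ∷ _) zero    = refl
coeff-+ (_ ∷ p) (_ ∷ q) (suc k) = coeff-+ p q k

coeff-scale : ∀ a p k → coeff (map (a ℤ.*_) p) k ≡ a ℤ.* coeff p k
coeff-scale a []      k       = sym (ℤ.*-zeroʳ a)
coeff-scale a (_ ∷ _) zero    = refl
coeff-scale a (_ ∷ p) (suc k) = coeff-scale a p k

coeff-neg : ∀ p k → coeff (map (λ a → ℤ.- a) p) k ≡ ℤ.- coeff p k
coeff-neg []      k       = refl
coeff-neg (_ ∷ _) zero    = refl
coeff-neg (_ ∷ p) (suc k) = coeff-neg p k

shift-+ : ∀ p q k → coeff (0ℤ ∷ (p +ₚ q)) k ≡ coeff (0ℤ ∷ p) k ℤ.+ coeff (0ℤ ∷ q) k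
shift-+ p q = coeff-+ (0ℤ ∷ p) (0ℤ ∷ q)

-- Zero has many representatives, since products leave trailing zeros; equality with `[]` would be
-- too strict.
Null : Poly → Set
Null p = ∀ k → coeff p k ≡ 0ℤ

shift-null : ∀ {p} → Null p → Null (0ℤ ∷ p)
shift-null null zero    = refl
shift-null null (suc k) = null k

+-null : ∀ p q → Null p → Null q → Null (p +ₚ q)
+-null p q p≈0 q≈0 k = trans (coeff-+ p q k) (cong₂ ℤ._+_ (p≈0 k) (q≈0 k))

neg-null : ∀ p → Null p → Null (map (λ a → ℤ.- a) p)
neg-null p p≈0 k = trans (coeff-neg p k) (cong (λ a → ℤ.- a) (p≈0 k))

*-nullʳ : ∀ p q → Null q → Null (p *ₚ q)
*-nullʳ []      q q≈0 k = refl
*-nullʳ (a ∷ p) q q≈0   = +-null (map (a ℤ.*_) q) (0ℤ ∷ (p *ₚ q))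
  (λ k → trans (coeff-scale a q k) (trans (cong (a ℤ.*_) (q≈0 k)) (ℤ.*-zeroʳ a)))
  (shift-null (*-nullʳ p q q≈0))

*-nullˡ : ∀ p q → Null p → Null (p *ₚ q)
*-nullˡ []      q p≈0 k = refl
*-nullˡ (a ∷ p) q p≈0   = +-null (map (a ℤ.*_) q) (0ℤ ∷ (p *ₚ q))
  (λ k → trans (coeff-scale a q k) (cong (ℤ._* coeff q k) (p≈0 0)))
  (shift-null (*-nullˡ p q (λ k → p≈0 (suc k))))

coeff-constant-* : ∀ a p k → coeff ((a ∷ []) *ₚ p) k ≡ a ℤ.* coeff p k
coeff-constant-* a p k = begin
  coeff ((a ∷ []) *ₚ p) k                        ≡⟨ coeff-+ (map (a ℤ.*_) p) _ k ⟩
  coeff (map (a ℤ.*_) p) k ℤ.+ coeff (0ℤ ∷ []) k ≡⟨ cong₂ ℤ._+_ (coeff-scale a p k) (shift-null (λ _ → refl) k) ⟩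
  a ℤ.* coeff p k ℤ.+ 0ℤ                         ≡⟨ ℤ.+-identityʳ _ ⟩
  a ℤ.* coeff p k                                ∎

coeff-linear-* : ∀ a b p k →
  coeff ((a ∷ b ∷ []) *ₚ p) k ≡ a ℤ.* coeff p k ℤ.+ b ℤ.* coeff (0ℤ ∷ p) k
coeff-linear-* a b p k = begin
  coeff ((a ∷ b ∷ []) *ₚ p) k
    ≡⟨ coeff-+ (map (a ℤ.*_) p) _ k ⟩
  coeff (map (a ℤ.*_) p) k ℤ.+ coeff (0ℤ ∷ ((b ∷ []) *ₚ p)) k
    ≡⟨ cong₂ ℤ._+_ (coeff-scale a p k) (shifted k) ⟩
  a ℤ.* coeff p k ℤ.+ b ℤ.* coeff (0ℤ ∷ p) k ∎
  where
  shifted : ∀ k → coeff (0ℤ ∷ ((b ∷ []) *ₚ p)) k ≡ b ℤ.* coeff (0ℤ ∷ p) k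
  shifted zero    = sym (ℤ.*-zeroʳ b)
  shifted (suc k) = coeff-constant-* b p k

-- The index map `g` is general because each induction step composes it with `suc`; it also covers
-- tails of a convolution.
∑-null : ∀ (t : ℕ → Poly) g n → (∀ i → Null (t (g i))) →
         Null (∑ ℤ[y] (map t (applyUpTo g n)))
∑-null t g zero    t≈0 k = refl
∑-null t g (suc n) t≈0   =
  +-null (t (g 0)) _ (t≈0 0) (∑-null t (λ i → g (suc i)) n (λ i → t≈0 (suc i)))

-- Degree bounds in `x` and truncated convolutions.

HasDegree≤ : ℕ → Series → Set
HasDegree≤ d f = ∀ i → d < i → Null (f i)

degree-weaken : ∀ {d e} f → d ≤ e → HasDegree≤ d f → HasDegree≤ e f
degree-weaken f d≤e deg i e<i = deg i (ℕ.≤-<-trans d≤e e<i)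

degree-1# : HasDegree≤ 0 1#
degree-1# (suc _) _ k = refl

degree-y : HasDegree≤ 0 y
degree-y (suc _) _ k = refl

degree-x : HasDegree≤ 1 x
degree-x (suc zero)    (ℕ.s≤s ()) k
degree-x (suc (suc _)) _          k = refl

degree-+ : ∀ {d} f g → HasDegree≤ d f → HasDegree≤ d g → HasDegree≤ d (f + g)
degree-+ f g df dg i d<i = +-null (f i) (g i) (df i d<i) (dg i d<i)

degree-neg : ∀ {d} f → HasDegree≤ d f → HasDegree≤ d (- f)
degree-neg f df i d<i = neg-null (f i) (df i d<i)

-- Every term of the convolution has a vanishing factor: either `i` exceeds `d`, or `n ∸ i` exceeds
-- `e`.
degree-* : ∀ {d e} f g → HasDegree≤ d f → HasDegree≤ e g → HasDegree≤ (d ℕ.+ e) (f * g)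
degree-* {d} {e} f g df dg n d+e<n = ∑-null (λ i → f i *ₚ g (n ∸ i)) (λ i → i) (suc n) term
  where
  term : ∀ i → Null (f i *ₚ g (n ∸ i))
  term i with i ≤? d
  ... | yes i≤d = *-nullʳ (f i) _ (dg (n ∸ i) (ℕ.m+n≤o⇒m≤o∸n (suc e)
          (ℕ.≤-trans (ℕ.+-monoʳ-≤ (suc e) i≤d)
            (subst (_< n) (ℕ.+-comm d e) d+e<n))))
  ... | no  i≰d = *-nullˡ (f i) _ (df i (ℕ.≰⇒> i≰d))

-- At index `2 + n` the first three terms of the convolution unfold by computation, and the degree
-- bound kills the remaining `n`.
quadratic-* : ∀ f g → HasDegree≤ 2 f → ∀ n k →
  coeff ((f * g) (2 ℕ.+ n)) k ≡
  coeff (f 0 *ₚ g (2 ℕ.+ n)) k ℤ.+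
  (coeff (f 1 *ₚ g (1 ℕ.+ n)) k ℤ.+ coeff (f 2 *ₚ g n) k)
quadratic-* f g df n k = begin
  coeff (p₀ +ₚ (p₁ +ₚ (p₂ +ₚ rest))) k
    ≡⟨ coeff-+ p₀ _ k ⟩
  c₀ ℤ.+ coeff (p₁ +ₚ (p₂ +ₚ rest)) k
    ≡⟨ cong (ℤ._+_ (c₀)) (coeff-+ p₁ _ k) ⟩
  c₀ ℤ.+ (c₁ ℤ.+ coeff (p₂ +ₚ rest) k)
    ≡⟨ cong (λ c → c₀ ℤ.+ (c₁ ℤ.+ c)) (coeff-+ p₂ rest k) ⟩
  c₀ ℤ.+ (c₁ ℤ.+ (c₂ ℤ.+ coeff rest k))
    ≡⟨ cong (λ c → c₀ ℤ.+ (c₁ ℤ.+ (c₂ ℤ.+ c))) (rest-null k) ⟩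
  c₀ ℤ.+ (c₁ ℤ.+ (c₂ ℤ.+ 0ℤ))
    ≡⟨ cong (λ c → c₀ ℤ.+ (c₁ ℤ.+ c)) (ℤ.+-identityʳ c₂) ⟩
  c₀ ℤ.+ (c₁ ℤ.+ c₂) ∎
  where
  p₀ = f 0 *ₚ g (2 ℕ.+ n)
  p₁ = f 1 *ₚ g (1 ℕ.+ n)
  p₂ = f 2 *ₚ g n
  c₀ = coeff p₀ k
  c₁ = coeff p₁ k
  c₂ = coeff p₂ k
  term : ℕ → Poly
  term i = f i *ₚ g (2 ℕ.+ n ∸ i)
  rest : Poly
  rest = ∑ ℤ[y] (map term (applyUpTo (λ i → 3 ℕ.+ i) n))
  rest-null : Null rest
  rest-null = ∑-null term (λ i → 3 ℕ.+ i) n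
    λ i → *-nullˡ (f (3 ℕ.+ i)) _ (df (3 ℕ.+ i) (ℕ.m≤m+n 3 i))

-- The fraction and its expansion.

numerator denominator : Series
numerator   = 1# + x ^ 2 - x ^ 2 * y
denominator = 1# - x - x ^ 2 * y

degree-x^2 : HasDegree≤ 2 (x ^ 2)
degree-x^2 = degree-* x (x * 1#) degree-x (degree-* x 1# degree-x degree-1#)

degree-x^2y : HasDegree≤ 2 (- (x ^ 2 * y))
degree-x^2y = degree-neg (x ^ 2 * y) (degree-* (x ^ 2) y degree-x^2 degree-y)

degree-numerator : HasDegree≤ 2 numerator
degree-numerator = degree-+ (1# + x ^ 2) (- (x ^ 2 * y))
  (degree-+ 1# (x ^ 2) (degree-weaken 1# ℕ.z≤n degree-1#) degree-x^2)
  degree-x^2y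

degree-denominator : HasDegree≤ 2 denominator
degree-denominator = degree-+ (1# - x) (- (x ^ 2 * y))
  (degree-+ 1# (- x) (degree-weaken 1# ℕ.z≤n degree-1#)
    (degree-weaken (- x) (ℕ.s≤s ℕ.z≤n) (degree-neg x degree-x)))
  degree-x^2y

-- The reciprocal of 1 - x - x²y.
fibonacci : Series
fibonacci zero          = [ 1ℤ ]
fibonacci (suc zero)    = [ 1ℤ ]
fibonacci (suc (suc n)) = fibonacci (suc n) +ₚ (0ℤ ∷ fibonacci n)

fibonacci-rec : ∀ n k → coeff (fibonacci (2 ℕ.+ n)) k ≡
                coeff (fibonacci (1 ℕ.+ n)) k ℤ.+ coeff (0ℤ ∷ fibonacci n) k
fibonacci-rec n = coeff-+ (fibonacci (suc n)) (0ℤ ∷ fibonacci n)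

denominator-inverse : denominator * fibonacci ≈ 1#
denominator-inverse 0 k = refl
-- The product at index 1 is a list of two zeros, not `[]`, so `k` is split until it passes the end.
denominator-inverse 1 zero = refl
denominator-inverse 1 (suc zero) = refl
denominator-inverse 1 (suc (suc k)) = refl
denominator-inverse (suc (suc n)) k = begin
  coeff ((denominator * fibonacci) (2 ℕ.+ n)) k
    ≡⟨ quadratic-* denominator fibonacci degree-denominator n k ⟩
  -- The literals are the computed coefficients `1`, `-1`, `-y` of the denominator; the zero ending
  -- the second comes from `x ^ 2 * y`.
  coeff ((1ℤ ∷ []) *ₚ fibonacci (2 ℕ.+ n)) k ℤ.+
  (coeff ((-1ℤ ∷ 0ℤ ∷ []) *ₚ fibonacci (1 ℕ.+ n)) k ℤ.+
   coeff ((0ℤ ∷ -1ℤ ∷ []) *ₚ fibonacci n) k)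
    ≡⟨ cong₂ ℤ._+_ (trans (coeff-constant-* 1ℤ (fibonacci (2 ℕ.+ n)) k) (cong (1ℤ ℤ.*_) (fibonacci-rec n k)))
        (cong₂ ℤ._+_ (coeff-linear-* -1ℤ 0ℤ (fibonacci (1 ℕ.+ n)) k) (coeff-linear-* 0ℤ -1ℤ (fibonacci n) k)) ⟩
  1ℤ ℤ.* (f₁ ℤ.+ sf₀) ℤ.+ ((-1ℤ ℤ.* f₁ ℤ.+ 0ℤ ℤ.* sf₁) ℤ.+ (0ℤ ℤ.* f₀ ℤ.+ -1ℤ ℤ.* sf₀))
    ≡⟨ cancel f₀ sf₀ f₁ sf₁ ⟩
  0ℤ ∎
  where
  f₀  = coeff (fibonacci n) k
  sf₀ = coeff (0ℤ ∷ fibonacci n) k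
  f₁  = coeff (fibonacci (1 ℕ.+ n)) k
  sf₁ = coeff (0ℤ ∷ fibonacci (1 ℕ.+ n)) k
  cancel : ∀ f₀ sf₀ f₁ sf₁ →
    1ℤ ℤ.* (f₁ ℤ.+ sf₀) ℤ.+ ((-1ℤ ℤ.* f₁ ℤ.+ 0ℤ ℤ.* sf₁) ℤ.+ (0ℤ ℤ.* f₀ ℤ.+ -1ℤ ℤ.* sf₀)) ≡ 0ℤ
  cancel = solve-∀

-- Expanding the leading term by the recurrence produces `y` times `fibonacci n`, which the
-- `- x ^ 2 * y` of the numerator cancels.
numerator-fibonacci : ∀ n k → coeff ((numerator * fibonacci) (2 ℕ.+ n)) k ≡
  coeff (fibonacci (1 ℕ.+ n)) k ℤ.+ coeff (fibonacci n) k
numerator-fibonacci n k = begin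
  coeff ((numerator * fibonacci) (2 ℕ.+ n)) k
    ≡⟨ quadratic-* numerator fibonacci degree-numerator n k ⟩
  coeff ((1ℤ ∷ []) *ₚ fibonacci (2 ℕ.+ n)) k ℤ.+
  (coeff ((0ℤ ∷ 0ℤ ∷ []) *ₚ fibonacci (1 ℕ.+ n)) k ℤ.+
   coeff ((1ℤ ∷ -1ℤ ∷ []) *ₚ fibonacci n) k)
    ≡⟨ cong₂ ℤ._+_ (trans (coeff-constant-* 1ℤ (fibonacci (2 ℕ.+ n)) k) (cong (1ℤ ℤ.*_) (fibonacci-rec n k)))
        (cong₂ ℤ._+_ (coeff-linear-* 0ℤ 0ℤ (fibonacci (1 ℕ.+ n)) k) (coeff-linear-* 1ℤ -1ℤ (fibonacci n) k)) ⟩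
  1ℤ ℤ.* (f₁ ℤ.+ sf₀) ℤ.+ ((0ℤ ℤ.* f₁ ℤ.+ 0ℤ ℤ.* sf₁) ℤ.+ (1ℤ ℤ.* f₀ ℤ.+ -1ℤ ℤ.* sf₀))
    ≡⟨ cancel f₀ sf₀ f₁ sf₁ ⟩
  f₁ ℤ.+ f₀ ∎
  where
  f₀  = coeff (fibonacci n) k
  sf₀ = coeff (0ℤ ∷ fibonacci n) k
  f₁  = coeff (fibonacci (1 ℕ.+ n)) k
  sf₁ = coeff (0ℤ ∷ fibonacci (1 ℕ.+ n)) k
  cancel : ∀ f₀ sf₀ f₁ sf₁ →
    1ℤ ℤ.* (f₁ ℤ.+ sf₀) ℤ.+ ((0ℤ ℤ.* f₁ ℤ.+ 0ℤ ℤ.* sf₁) ℤ.+ (1ℤ ℤ.* f₀ ℤ.+ -1ℤ ℤ.* sf₀)) ≡ f₁ ℤ.+ f₀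
  cancel = solve-∀

-- Descent distributions of lists of words.

avoiding? = avoids? _≤?_ _<?_

-- This is the sum defining `C`, freed from `catalanWords` so that lists can be split and words
-- prefixed.
desDistribution : List Word → Poly
desDistribution ws = ∑ ℤ[y] (map (λ w → y^ des w) (filter avoiding? ws))

∑-++ : ∀ ps qs k → coeff (∑ ℤ[y] (ps ++ qs)) k ≡ coeff (∑ ℤ[y] ps) k ℤ.+ coeff (∑ ℤ[y] qs) k
∑-++ []       qs k = sym (ℤ.+-identityˡ _)
∑-++ (p ∷ ps) qs k = begin
  coeff (p +ₚ ∑ ℤ[y] (ps ++ qs)) k                               ≡⟨ coeff-+ p _ k ⟩
  coeff p k ℤ.+ coeff (∑ ℤ[y] (ps ++ qs)) k                      ≡⟨ cong (ℤ._+_ (coeff p k)) (∑-++ ps qs k) ⟩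
  coeff p k ℤ.+ (coeff (∑ ℤ[y] ps) k ℤ.+ coeff (∑ ℤ[y] qs) k)    ≡⟨ ℤ.+-assoc (coeff p k) _ _ ⟨
  (coeff p k ℤ.+ coeff (∑ ℤ[y] ps) k) ℤ.+ coeff (∑ ℤ[y] qs) k    ≡⟨ cong (ℤ._+ _) (coeff-+ p _ k) ⟨
  coeff (p +ₚ ∑ ℤ[y] ps) k ℤ.+ coeff (∑ ℤ[y] qs) k               ∎

desDistribution-++ : ∀ ws vs k →
  coeff (desDistribution (ws ++ vs)) k ≡ coeff (desDistribution ws) k ℤ.+ coeff (desDistribution vs) k
desDistribution-++ ws vs k = trans
  (cong (λ us → coeff (∑ ℤ[y] us) k)
    (trans (cong (map (λ w → y^ des w)) (filter-++ avoiding? ws vs))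
           (map-++ (λ w → y^ des w) (filter avoiding? ws) (filter avoiding? vs))))
  (∑-++ (map (λ w → y^ des w) (filter avoiding? ws)) (map (λ w → y^ des w) (filter avoiding? vs)) k)

-- Sorts words by their next letter, `f` restoring the letters already read. The `concat` is
-- `wordsFrom` unfolded, with an arbitrary list `cs` of letters to allow induction.
desDistribution-extend : ∀ (f : Word → Word) n cs k →
  coeff (desDistribution (map f (concat (map (λ c → map (c ∷_) (wordsFrom (suc c) n)) cs)))) k ≡
  coeff (∑ ℤ[y] (map (λ c → desDistribution (map (λ w → f (c ∷ w)) (wordsFrom (suc c) n))) cs)) k
desDistribution-extend f n []       k = refl
desDistribution-extend f n (c ∷ cs) k = begin
  coeff (desDistribution (map f (map (c ∷_) ws ++ rest))) k
    ≡⟨ cong (λ us → coeff (desDistribution us) k) (map-++ f (map (c ∷_) ws) rest) ⟩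
  coeff (desDistribution (map f (map (c ∷_) ws) ++ map f rest)) k
    ≡⟨ cong (λ us → coeff (desDistribution (us ++ map f rest)) k) (map-∘ ws) ⟨
  coeff (desDistribution (map (λ w → f (c ∷ w)) ws ++ map f rest)) k
    ≡⟨ desDistribution-++ (map (λ w → f (c ∷ w)) ws) (map f rest) k ⟩
  coeff (desDistribution (map (λ w → f (c ∷ w)) ws)) k ℤ.+ coeff (desDistribution (map f rest)) k
    ≡⟨ cong (ℤ._+_ (coeff (desDistribution (map (λ w → f (c ∷ w)) ws)) k)) (desDistribution-extend f n cs k) ⟩
  coeff (desDistribution (map (λ w → f (c ∷ w)) ws)) k ℤ.+
  coeff (∑ ℤ[y] (map (λ b → desDistribution (map (λ w → f (b ∷ w)) (wordsFrom (suc b) n))) cs)) k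
    ≡⟨ coeff-+ (desDistribution (map (λ w → f (c ∷ w)) ws)) _ k ⟨
  coeff (∑ ℤ[y] (map (λ b → desDistribution (map (λ w → f (b ∷ w)) (wordsFrom (suc b) n))) (c ∷ cs))) k ∎
  where
  ws   = wordsFrom (suc c) n
  rest = concat (map (λ b → map (b ∷_) (wordsFrom (suc b) n)) cs)

module _ (f : Word → Word) where

  -- Asking only for the Boolean `does` lets `refl` discharge the hypothesis once a concrete prefix
  -- contains the pattern, whatever `w` is.
  map-forbidden : (∀ w → does (avoiding? (f w)) ≡ false) →
                  ∀ ws → desDistribution (map f ws) ≡ []
  map-forbidden no-f []       = refl
  map-forbidden no-f (w ∷ ws) with does (avoiding? (f w)) | no-f w
  ... | _ | refl = map-forbidden no-f ws

  module _ (g : Word → Word) (same : ∀ w → does (avoiding? (f w)) ≡ does (avoiding? (g w))) where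

    map-level : (∀ w → des (f w) ≡ des (g w)) →
                ∀ ws → desDistribution (map f ws) ≡ desDistribution (map g ws)
    map-level des≡ []       = refl
    map-level des≡ (w ∷ ws) with does (avoiding? (f w)) | does (avoiding? (g w)) | same w
    ... | false | _ | refl = map-level des≡ ws
    ... | true  | _ | refl = cong₂ (λ d p → (y^ d) +ₚ p) (des≡ w) (map-level des≡ ws)

    -- Prepending `0ℤ` multiplies by `y`, which accounts for the extra descent. Only coefficients
    -- agree: for no words the two lists are `[]` and `0ℤ ∷ []`.
    map-descent : (∀ w → des (f w) ≡ suc (des (g w))) →
                  ∀ ws k → coeff (desDistribution (map f ws)) k ≡ coeff (0ℤ ∷ desDistribution (map g ws)) k
    map-descent des≡ []       k = sym (shift-null (λ _ → refl) k)
    map-descent des≡ (w ∷ ws) k with does (avoiding? (f w)) | does (avoiding? (g w)) | same w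
    ... | false | _ | refl = map-descent des≡ ws k
    ... | true  | _ | refl = begin
      coeff ((y^ des (f w)) +ₚ desDistribution (map f ws)) k
        ≡⟨ coeff-+ (y^ des (f w)) _ k ⟩
      coeff (y^ des (f w)) k ℤ.+ coeff (desDistribution (map f ws)) k
        ≡⟨ cong₂ ℤ._+_ (cong (λ d → coeff (y^ d) k) (des≡ w)) (map-descent des≡ ws k) ⟩
      coeff (0ℤ ∷ (y^ des (g w))) k ℤ.+ coeff (0ℤ ∷ desDistribution (map g ws)) k
        ≡⟨ shift-+ (y^ des (g w)) _ k ⟨
      coeff (0ℤ ∷ ((y^ des (g w)) +ₚ desDistribution (map g ws))) k ∎

-- Transfer between two-letter states.

-- Over the avoiding words abw in which |w| = n and each letter of w exceeds its
-- predecessor by at most one; a and b themselves are not constrained.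
after : (a b n : ℕ) → Poly
after a b n = desDistribution (map (λ w → a ∷ b ∷ w) (wordsFrom (suc b) n))

after₃ : (a b c n : ℕ) → Poly
after₃ a b c n = desDistribution (map (λ w → a ∷ b ∷ c ∷ w) (wordsFrom (suc c) n))

after-suc : ∀ a b n k → coeff (after a b (suc n)) k ≡
            coeff (∑ ℤ[y] (map (λ c → after₃ a b c n) (upTo (2 ℕ.+ b)))) k
after-suc a b n = desDistribution-extend (λ w → a ∷ b ∷ w) n (upTo (2 ℕ.+ b))

∑₂ : ∀ p q k → coeff (∑ ℤ[y] (p ∷ q ∷ [])) k ≡ coeff p k ℤ.+ coeff q k
∑₂ p q k = trans (coeff-+ p _ k)
  (cong (ℤ._+_ (coeff p k)) (trans (coeff-+ q [] k) (ℤ.+-identityʳ _)))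

-- A rise after 00 is forbidden, and deleting one of three initial zeros changes neither avoidance
-- nor descents.
after-00 : ∀ n k → coeff (after 0 0 (suc n)) k ≡ coeff (after 0 0 n) k
after-00 n k = begin
  coeff (after 0 0 (suc n)) k
    ≡⟨ after-suc 0 0 n k ⟩
  coeff (∑ ℤ[y] (after₃ 0 0 0 n ∷ after₃ 0 0 1 n ∷ [])) k
    ≡⟨ ∑₂ (after₃ 0 0 0 n) (after₃ 0 0 1 n) k ⟩
  coeff (after₃ 0 0 0 n) k ℤ.+ coeff (after₃ 0 0 1 n) k
    ≡⟨ cong₂ (λ p q → coeff p k ℤ.+ coeff q k) level forbidden ⟩
  coeff (after 0 0 n) k ℤ.+ 0ℤ
    ≡⟨ ℤ.+-identityʳ _ ⟩
  coeff (after 0 0 n) k ∎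
  where
  level : after₃ 0 0 0 n ≡ after 0 0 n
  level = map-level (λ w → 0 ∷ 0 ∷ 0 ∷ w) (λ w → 0 ∷ 0 ∷ w)
            (λ _ → refl) (λ _ → refl) (wordsFrom 1 n)
  forbidden : after₃ 0 0 1 n ≡ []
  forbidden = map-forbidden (λ w → 0 ∷ 0 ∷ 1 ∷ w) (λ _ → refl) (wordsFrom 2 n)

after-01 : ∀ n k → coeff (after 0 1 (suc n)) k ≡ coeff (after 1 0 n) k ℤ.+ coeff (after 0 1 n) k
after-01 n k = begin
  coeff (after 0 1 (suc n)) k
    ≡⟨ after-suc 0 1 n k ⟩
  coeff (∑ ℤ[y] (after₃ 0 1 0 n ∷ after₃ 0 1 1 n ∷ after₃ 0 1 2 n ∷ [])) k
    -- Once the third summand is `[]` as a list, the sum reduces to one of two terms.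
    ≡⟨ cong (λ p → coeff (after₃ 0 1 0 n +ₚ (after₃ 0 1 1 n +ₚ (p +ₚ []))) k) forbidden ⟩
  coeff (∑ ℤ[y] (after₃ 0 1 0 n ∷ after₃ 0 1 1 n ∷ [])) k
    ≡⟨ ∑₂ (after₃ 0 1 0 n) (after₃ 0 1 1 n) k ⟩
  coeff (after₃ 0 1 0 n) k ℤ.+ coeff (after₃ 0 1 1 n) k
    ≡⟨ cong₂ (λ p q → coeff p k ℤ.+ coeff q k) fall level ⟩
  coeff (after 1 0 n) k ℤ.+ coeff (after 0 1 n) k ∎
  where
  fall : after₃ 0 1 0 n ≡ after 1 0 n
  fall = map-level (λ w → 0 ∷ 1 ∷ 0 ∷ w) (λ w → 1 ∷ 0 ∷ w)
           (λ _ → refl) (λ _ → refl) (wordsFrom 1 n)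
  -- The avoiding words 11w and 01w have the same continuations w.
  level : after₃ 0 1 1 n ≡ after 0 1 n
  level = map-level (λ w → 0 ∷ 1 ∷ 1 ∷ w) (λ w → 0 ∷ 1 ∷ w)
            (λ { [] → refl ; (_ ∷ _) → refl }) (λ _ → refl) (wordsFrom 2 n)
  forbidden : after₃ 0 1 2 n ≡ []
  forbidden = map-forbidden (λ w → 0 ∷ 1 ∷ 2 ∷ w) (λ _ → refl) (wordsFrom 3 n)

-- Here both 0 and 1 may follow, as the leading 1 lies in no pattern. Deleting it loses exactly one
-- descent, whence the shift.
after-10 : ∀ n k → coeff (after 1 0 (suc n)) k ≡
           coeff (0ℤ ∷ after 0 0 n) k ℤ.+ coeff (0ℤ ∷ after 0 1 n) k
after-10 n k = begin
  coeff (after 1 0 (suc n)) k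
    ≡⟨ after-suc 1 0 n k ⟩
  coeff (∑ ℤ[y] (after₃ 1 0 0 n ∷ after₃ 1 0 1 n ∷ [])) k
    ≡⟨ ∑₂ (after₃ 1 0 0 n) (after₃ 1 0 1 n) k ⟩
  coeff (after₃ 1 0 0 n) k ℤ.+ coeff (after₃ 1 0 1 n) k
    ≡⟨ cong₂ ℤ._+_
         (map-descent (λ w → 1 ∷ 0 ∷ 0 ∷ w) (λ w → 0 ∷ 0 ∷ w)
           (λ _ → refl) (λ _ → refl) (wordsFrom 1 n) k)
         (map-descent (λ w → 1 ∷ 0 ∷ 1 ∷ w) (λ w → 0 ∷ 1 ∷ w)
           (λ _ → refl) (λ _ → refl) (wordsFrom 2 n) k) ⟩
  coeff (0ℤ ∷ after 0 0 n) k ℤ.+ coeff (0ℤ ∷ after 0 1 n) k ∎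

-- Solving the recurrences.

mutual

  -- The two states are never solved separately: by `after-00` and `after-01`, advancing `n`
  -- increases their sum by `after 1 0 n`, while `after-10` returns `y` times that sum.
  after-00+01 : ∀ n k → coeff (after 0 0 n) k ℤ.+ coeff (after 0 1 n) k ≡
                coeff (fibonacci (1 ℕ.+ n)) k ℤ.+ coeff (fibonacci n) k
  after-00+01 zero    k = refl
  after-00+01 (suc n) k = begin
    coeff (after 0 0 (suc n)) k ℤ.+ coeff (after 0 1 (suc n)) k
      ≡⟨ cong₂ ℤ._+_ (after-00 n k) (after-01 n k) ⟩
    a ℤ.+ (d ℤ.+ b)      ≡⟨ swap a d b ⟩
    d ℤ.+ (a ℤ.+ b)      ≡⟨ cong (ℤ._+_ d) (after-00+01 n k) ⟩
    d ℤ.+ (f₁ ℤ.+ f₀)    ≡⟨ regroup d f₁ f₀ ⟩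
    (d ℤ.+ f₀) ℤ.+ f₁    ≡⟨ cong (ℤ._+ f₁) (after-10+fibonacci n k) ⟩
    coeff (fibonacci (2 ℕ.+ n)) k ℤ.+ f₁ ∎
    where
    a  = coeff (after 0 0 n) k
    b  = coeff (after 0 1 n) k
    d  = coeff (after 1 0 n) k
    f₀ = coeff (fibonacci n) k
    f₁ = coeff (fibonacci (1 ℕ.+ n)) k
    swap : ∀ a d b → a ℤ.+ (d ℤ.+ b) ≡ d ℤ.+ (a ℤ.+ b)
    swap = solve-∀
    regroup : ∀ d f₁ f₀ → d ℤ.+ (f₁ ℤ.+ f₀) ≡ (d ℤ.+ f₀) ℤ.+ f₁
    regroup = solve-∀

  -- Solves state 10 as a difference of two terms of `fibonacci`, written additively to avoid
  -- subtraction.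
  after-10+fibonacci : ∀ n k → coeff (after 1 0 n) k ℤ.+ coeff (fibonacci n) k ≡
                       coeff (fibonacci (2 ℕ.+ n)) k
  after-10+fibonacci zero    zero          = refl
  after-10+fibonacci zero    (suc zero)    = refl
  after-10+fibonacci zero    (suc (suc k)) = refl
  after-10+fibonacci (suc n) k = begin
    coeff (after 1 0 (suc n)) k ℤ.+ f₁  ≡⟨ cong (ℤ._+ f₁) (trans (after-10 n k) (shifted k)) ⟩
    (sf₁ ℤ.+ sf₀) ℤ.+ f₁                ≡⟨ regroup sf₁ sf₀ f₁ ⟩
    (f₁ ℤ.+ sf₀) ℤ.+ sf₁                ≡⟨ cong (ℤ._+ sf₁) (fibonacci-rec n k) ⟨
    coeff (fibonacci (2 ℕ.+ n)) k ℤ.+ sf₁ ≡⟨ fibonacci-rec (suc n) k ⟨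
    coeff (fibonacci (3 ℕ.+ n)) k ∎
    where
    f₁  = coeff (fibonacci (1 ℕ.+ n)) k
    sf₀ = coeff (0ℤ ∷ fibonacci n) k
    sf₁ = coeff (0ℤ ∷ fibonacci (1 ℕ.+ n)) k
    shifted : ∀ k → coeff (0ℤ ∷ after 0 0 n) k ℤ.+ coeff (0ℤ ∷ after 0 1 n) k ≡
              coeff (0ℤ ∷ fibonacci (1 ℕ.+ n)) k ℤ.+ coeff (0ℤ ∷ fibonacci n) k
    shifted zero    = refl
    shifted (suc k) = after-00+01 n k
    regroup : ∀ s₁ s₀ f → (s₁ ℤ.+ s₀) ℤ.+ f ≡ (f ℤ.+ s₀) ℤ.+ s₁
    regroup = solve-∀

-- Comparison with the generating function.

C-suc-suc : ∀ n k → coeff (C _≤?_ _<?_ (2 ℕ.+ n)) k ≡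
            coeff (after 0 0 n) k ℤ.+ coeff (after 0 1 n) k
C-suc-suc n k = begin
  coeff (desDistribution (map (0 ∷_) (wordsFrom 1 (suc n)) ++ [])) k
    -- The only possible first letter is 0, so the outer `concat` is one block followed by `[]`.
    ≡⟨ cong (λ ws → coeff (desDistribution ws) k) (++-identityʳ (map (0 ∷_) (wordsFrom 1 (suc n)))) ⟩
  coeff (desDistribution (map (0 ∷_) (wordsFrom 1 (suc n)))) k
    ≡⟨ desDistribution-extend (0 ∷_) n (0 ∷ 1 ∷ []) k ⟩
  coeff (∑ ℤ[y] (after 0 0 n ∷ after 0 1 n ∷ [])) k
    ≡⟨ ∑₂ (after 0 0 n) (after 0 1 n) k ⟩
  coeff (after 0 0 n) k ℤ.+ coeff (after 0 1 n) k ∎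

theorem3p19 : C _≤?_ _<?_ ≈ (1# + x ^ 2 - x ^ 2 * y) / (1# - x - x ^ 2 * y)
theorem3p19 = fibonacci , denominator-inverse , C≈
  where
  C≈ : C _≤?_ _<?_ ≈ numerator * fibonacci
  -- Lengths 0 and 1 have no two-letter prefix and are settled by computation.
  C≈ 0 k = refl
  C≈ 1 zero = refl
  C≈ 1 (suc zero) = refl
  C≈ 1 (suc (suc k)) = refl
  C≈ (suc (suc n)) k =
    trans (C-suc-suc n k) (trans (after-00+01 n k) (sym (numerator-fibonacci n k)))
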